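{- Let $M$ be an indecomposable $n\times n$ binary matrix with period $d$ and index $\gamma$, let $G$ be the digraph with adjacency matrix $M$ (that is, the underlying digraph of the level poset $P$ of $M$), and let $<$ be a linear order on the vertex set $V$ of $G$. Then $<$ is a vertex shelling order for $G$ if and only if the vertex shelling condition $(S_k)$ holds for all $k\le \gamma+d$, where $(S_k)$ is the following condition: for any $u,v\in V$ and every pair of walks $u=v_0\to v_1\to\cdots\to v_k=v$ and $u=v_0'\to v_1'\to\cdots\to v_k'=v$ of length $k$ in $G$ with $v_1'<v_1$, there are a $j\in\{1,\dots,k-1\}$ and a vertex $w\in V$ such that $w<v_j$ and both $v_{j-1}\to w$ and $w\to v_{j+1}$ are edges of $G$.
   Context: A linear order $<$ on the vertex set of a digraph $G$ is a vertex shelling order if condition $(S_k)$ of the claim holds for every $k\ge1$. For a square matrix $A$ with nonnegative entries, $\operatorname{Bin}(A)$ is the $0/1$ matrix obtained by replacing each nonzero entry of $A$ by $1$. A nonnegative square matrix $M$ is indecomposable if for all $i,j$ there is $t>0$ with $(M^t)_{i,j}>0$. Its period $d$ is the greatest common divisor of all positive integers $k$ with $(M^k)_{i,i}>0$ (independent of $i$). Its index $\gamma$ is the smallest nonnegative integer such that $\operatorname{Bin}(M^{t+d})=\operatorname{Bin}(M^{t})$ for all $t\ge\gamma$. The digraph with adjacency matrix $M$ has an edge $u\to v$ exactly when $M_{u,v}=1$ (loops allowed). -}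

module Defs where

open import Level using (Level)
open import Data.Nat using (ℕ; zero; suc; _+_; _*_; _≤_; _<_; NonZero)
open import Data.Nat.Properties using (+-*-semiring)
open import Data.Nat.Divisibility using (_∣_)
open import Data.Fin using (Fin; zero; suc; inject₁; fromℕ; _≟_)
open import Data.Product using (_×_; ∃-syntax)
open import Data.Sum using (_⊎_)
open import Relation.Binary.Core using (Rel)
open import Relation.Binary.PropositionalEquality using (_≡_)
open import Relation.Nullary using (does)
open import Data.Bool using (if_then_else_)
open import Algebra.Properties.Semiring.Sum +-*-semiring using (sum)

private
  variable
    n : ℕ
    ℓ : Level

-- Every matrix considered is a power of a binary matrix, or Bin of one, so
-- natural number entries suffice.
Matrix : ℕ → Set
Matrix n = Fin n → Fin n → ℕ

IsBinary : Matrix n → Set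
IsBinary M = ∀ i j → M i j ≡ 0 ⊎ M i j ≡ 1

𝟙 : Matrix n
𝟙 i j = if does (i ≟ j) then 1 else 0

infixl 7 _·_
_·_ : Matrix n → Matrix n → Matrix n
(A · B) i j = sum λ k → A i k * B k j

infixr 8 _^_
_^_ : Matrix n → ℕ → Matrix n
M ^ zero  = 𝟙
M ^ suc k = M · M ^ k

bin : ℕ → ℕ
bin zero    = 0
bin (suc _) = 1

Bin : Matrix n → Matrix n
Bin A i j = bin (A i j)

Indecomposable : Matrix n → Set
Indecomposable M = ∀ i j → ∃[ t ] 0 < t × 0 < (M ^ t) i j

-- The gcd of a possibly infinite set of naturals, by its universal property.
IsGCDOf : (ℕ → Set) → ℕ → Set
IsGCDOf S d = (∀ k → S k → d ∣ k) × (∀ e → (∀ k → S k → e ∣ k) → e ∣ d)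

-- The period is computed at a chosen index i; that it does not depend on i
-- when M is indecomposable is not built in.
IsPeriodAt : Matrix n → Fin n → ℕ → Set
IsPeriodAt M i = IsGCDOf λ k → 0 < k × 0 < (M ^ k) i i

BinPeriodicFrom : Matrix n → ℕ → ℕ → Set
BinPeriodicFrom M d s =
  ∀ t → s ≤ t → ∀ i j → Bin (M ^ (t + d)) i j ≡ Bin (M ^ t) i j

IsIndex : Matrix n → ℕ → ℕ → Set
IsIndex M d γ = BinPeriodicFrom M d γ × (∀ s → BinPeriodicFrom M d s → γ ≤ s)

Edge : Matrix n → Fin n → Fin n → Set
Edge M u v = M u v ≡ 1

record Walk (M : Matrix n) (k : ℕ) (u v : Fin n) : Set where
  field
    vertex : Fin (suc k) → Fin n
    start  : vertex zero ≡ u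
    end    : vertex (fromℕ k) ≡ v
    step   : ∀ (i : Fin k) → Edge M (vertex (inject₁ i)) (vertex (suc i))

open Walk public

-- Condition (S_k), for k ≥ 1.  With k = suc m, the interior position
-- j ∈ {1, …, k - 1} is written j = 1 + i with i : Fin m; the positions
-- j - 1, j, j + 1 are then the three arguments of `vertex p` below.
ShellingCondition : Matrix n → Rel (Fin n) ℓ → (k : ℕ) → .{{NonZero k}} → Set ℓ
ShellingCondition M _≺_ (suc m) =
  ∀ u v (p p′ : Walk M (suc m) u v) →
  vertex p′ (suc zero) ≺ vertex p (suc zero) →
  ∃[ i ] ∃[ w ]
    w ≺ vertex p (suc (inject₁ {m} i)) ×
    Edge M (vertex p (inject₁ (inject₁ i))) w ×
    Edge M w (vertex p (suc (suc i)))

IsVertexShellingOrder : Matrix n → Rel (Fin n) ℓ → Set ℓ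
IsVertexShellingOrder M _≺_ = ∀ k → .{{_ : NonZero k}} → ShellingCondition M _≺_ k

{-# OPTIONS --safe #-}

-- Only the first edge of the second walk enters (S_k).  If k > γ + d, let x be
-- the vertex v_{γ+1} of the first walk.  Returning from v to x by
-- indecomposability gives a walk from v₁′ to x whose length exceeds γ by the
-- length of a closed walk through x, hence by a multiple of d; since γ is the
-- index, there is then such a walk of length exactly γ.  So (S_k) for the two
-- given walks follows from (S_{γ+1}) for the prefix of the first one, and
-- γ + 1 ≤ γ + d because d > 0.
module Submission where

open import Defs
open import Level using (Level)
open import Data.Nat using (ℕ; zero; suc; _+_; _*_; _≤_; _<_; s≤s; z<s; NonZero)
open import Data.Nat.Properties hiding (_≟_)
open import Data.Nat.Divisibility using (_∣_; divides; 0∣⇒≡0; ∣m+n∣m⇒∣n)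
open import Data.Nat.Tactic.RingSolver using (solve-∀)
open import Data.Fin using (Fin; zero; suc; inject₁; fromℕ; _↑ˡ_; _≟_)
open import Data.Product using (_×_; _,_; ∃-syntax)
open import Data.Sum using (inj₁; inj₂)
open import Function.Base using (_∘_)
open import Function.Bundles using (_⇔_; mk⇔)
open import Relation.Binary.Core using (Rel)
open import Relation.Binary.Structures using (IsStrictTotalOrder)
open import Relation.Binary.PropositionalEquality using (_≡_; refl; sym; trans; cong; subst)
open import Relation.Nullary using (yes; no; contradiction)
open import Algebra.Properties.Semiring.Sum +-*-semiring using (sum)

private
  variable
    n : ℕ
    M : Matrix n
    u v w : Fin n

sum>0⇒term>0 : ∀ {n} (f : Fin n → ℕ) → 0 < sum f → ∃[ i ] 0 < f i
sum>0⇒term>0 {suc n} f pos with f zero in eq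
... | suc _ = zero , subst (0 <_) (sym eq) z<s
... | zero  = let i , q = sum>0⇒term>0 (f ∘ suc) pos in suc i , q

term>0⇒sum>0 : ∀ {n} (f : Fin n → ℕ) i → 0 < f i → 0 < sum f
term>0⇒sum>0 f zero    pos = ≤-trans pos (m≤m+n _ _)
term>0⇒sum>0 f (suc i) pos = ≤-trans (term>0⇒sum>0 (f ∘ suc) i pos) (m≤n+m _ (f zero))

*-pos : ∀ {a b} → 0 < a → 0 < b → 0 < a * b
*-pos {suc _} {suc _} _ _ = z<s

*-pos⁻¹ : ∀ a b → 0 < a * b → 0 < a × 0 < b
*-pos⁻¹ (suc a) (suc b) _ = z<s , z<s
*-pos⁻¹ (suc a) zero pos = contradiction pos (<-irrefl (sym (*-zeroʳ a)))

·-pos : (A B : Matrix n) → 0 < A u w → 0 < B w v → 0 < (A · B) u v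
·-pos {w = w} A B a b = term>0⇒sum>0 _ w (*-pos a b)

·-pos⁻¹ : (A B : Matrix n) → 0 < (A · B) u v → ∃[ w ] 0 < A u w × 0 < B w v
·-pos⁻¹ {u = u} {v} A B pos =
  let w , q = sum>0⇒term>0 _ pos in w , *-pos⁻¹ (A u w) (B w v) q

𝟙-pos : u ≡ v → 0 < 𝟙 u v
𝟙-pos {u = u} {v} u≡v with u ≟ v
... | yes _  = z<s
... | no u≢v = contradiction u≡v u≢v

𝟙-pos⁻¹ : 0 < 𝟙 u v → u ≡ v
𝟙-pos⁻¹ {u = u} {v} pos with u ≟ v
... | yes u≡v = u≡v
... | no _    = contradiction pos λ ()

-- Concatenation of walks at the level of positive entries, so that no vertex sequences have to be
-- glued; `walk⇒pos` and `pos⇒walk` translate.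
^-pos-+ : ∀ a {b} → 0 < (M ^ a) u w → 0 < (M ^ b) w v → 0 < (M ^ (a + b)) u v
^-pos-+ {M = M} {v = v} zero {b} p q = subst (λ z → 0 < (M ^ b) z v) (sym (𝟙-pos⁻¹ p)) q
^-pos-+ {M = M} (suc a) {b} p q =
  let x , e , p′ = ·-pos⁻¹ M (M ^ a) p
  in ·-pos M (M ^ (a + b)) e (^-pos-+ a p′ q)

edge : IsBinary M → 0 < M u v → Edge M u v
edge {u = u} {v} binary pos with binary u v
... | inj₁ ≡0 = contradiction (sym ≡0) (<⇒≢ pos)
... | inj₂ ≡1 = ≡1

cons : ∀ {k} → Edge M u w → Walk M k w v → Walk M (suc k) u v
cons {u = u} e p .vertex zero    = u
cons         e p .vertex (suc i) = vertex p i
cons         e p .start          = refl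
cons         e p .end            = end p
cons {M = M} e p .step zero      = subst (Edge M _) (sym (start p)) e
cons         e p .step (suc i)   = step p i

tail : ∀ {k} (p : Walk M (suc k) u v) → Walk M k (vertex p (suc zero)) v
tail p = record { vertex = vertex p ∘ suc ; start = refl ; end = end p ; step = step p ∘ suc }

first-edge : ∀ {k} (p : Walk M (suc k) u v) → Edge M u (vertex p (suc zero))
first-edge {M = M} p = subst (λ z → Edge M z _) (start p) (step p zero)

-- Reconciles the two ways in which a position of a prefix is read as a position of the whole walk.
inject₁-↑ˡ : ∀ {m} (i : Fin m) r → inject₁ (i ↑ˡ r) ≡ inject₁ i ↑ˡ r
inject₁-↑ˡ zero    r = refl
inject₁-↑ˡ (suc i) r = cong suc (inject₁-↑ˡ i r)

prefix : ∀ k {r} (p : Walk M (k + r) u v) → Walk M k u (vertex p (fromℕ k ↑ˡ r))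
prefix         k {r} p .vertex i = vertex p (i ↑ˡ r)
prefix         k {r} p .start    = start p
prefix         k {r} p .end      = refl
prefix {M = M} k {r} p .step i   =
  subst (λ z → Edge M (vertex p z) (vertex p (suc i ↑ˡ r))) (inject₁-↑ˡ i r) (step p (i ↑ˡ r))

walk⇒pos : ∀ k → Walk M k u v → 0 < (M ^ k) u v
walk⇒pos zero p = 𝟙-pos (trans (sym (start p)) (end p))
walk⇒pos {M = M} (suc k) p =
  ·-pos M (M ^ k) (subst (0 <_) (sym (first-edge p)) z<s) (walk⇒pos k (tail p))

pos⇒walk : IsBinary M → ∀ k → 0 < (M ^ k) u v → Walk M k u v
pos⇒walk {u = u} binary zero pos =
  record { vertex = λ _ → u ; start = refl ; end = 𝟙-pos⁻¹ pos ; step = λ () }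
pos⇒walk {M = M} binary (suc k) pos =
  let x , e , q = ·-pos⁻¹ M (M ^ k) pos in cons (edge binary e) (pos⇒walk binary k q)

suffix-pos : ∀ k {r} (p : Walk M (k + r) u v) → 0 < (M ^ r) (vertex p (fromℕ k ↑ˡ r)) v
suffix-pos {M = M} {v = v} zero {r} p =
  subst (λ z → 0 < (M ^ r) z v) (sym (start p)) (walk⇒pos r p)
suffix-pos (suc k) p = suffix-pos k (tail p)

-- Take a closed walk from `i` through `u`, and the same walk with the given loop at `u` inserted.
-- `d` divides both lengths, hence their difference `l`.
period∣closed : Indecomposable M → ∀ {i d} → IsPeriodAt M i d →
                ∀ {l} → 0 < (M ^ l) u u → d ∣ l
period∣closed {M = M} {u = u} indec {i} {d} (d∣ , _) {l} closed =
  let a , a>0 , iu = indec i u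
      b , _   , ui = indec u i
      short = d∣ (a + b) (≤-trans a>0 (m≤m+n a b) , ^-pos-+ a iu ui)
      long  = d∣ (a + (l + b)) (≤-trans a>0 (m≤m+n a _) , ^-pos-+ a iu (^-pos-+ l closed ui))
  in ∣m+n∣m⇒∣n (subst (d ∣_) (rearrange a l b) long) short
  where
  rearrange : ∀ a l b → a + (l + b) ≡ (a + b) + l
  rearrange = solve-∀

-- Some closed walk at `i` has positive length, and 0 divides no positive number.
period>0 : Indecomposable M → ∀ {i d} → IsPeriodAt M i d → 0 < d
period>0 indec {d = suc _} _ = z<s
period>0 indec {i} {zero} (d∣ , _) =
  let t , t>0 , pos = indec i i
  in contradiction (sym (0∣⇒≡0 (d∣ t (t>0 , pos)))) (<⇒≢ t>0)

bin-pos : ∀ {a b} → bin a ≡ bin b → 0 < a → 0 < b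
bin-pos {suc _} {suc _} _  _ = z<s
bin-pos {suc _} {zero}  () _

-- Each induction step strips one period; the exponent left is still at least `γ`, so periodicity
-- applies again.
reduce-length : ∀ {d γ} → BinPeriodicFrom M d γ →
                ∀ c → 0 < (M ^ (γ + c * d)) u v → 0 < (M ^ γ) u v
reduce-length {M = M} {u = u} {v} {d} {γ} per zero pos =
  subst (λ t → 0 < (M ^ t) u v) (+-identityʳ γ) pos
reduce-length {M = M} {u = u} {v} {d} {γ} per (suc c) pos =
  reduce-length per c
    (bin-pos (per (γ + c * d) (m≤m+n γ _) u v)
      (subst (λ t → 0 < (M ^ t) u v) (rearrange γ c d) pos))
  where
  rearrange : ∀ γ c d → γ + suc c * d ≡ γ + c * d + d
  rearrange = solve-∀

module _ (binary : IsBinary M) (indec : Indecomposable M)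
         {i d γ} (period : IsPeriodAt M i d) (periodic : BinPeriodicFrom M d γ) where

  reroute : ∀ {r x} → 0 < (M ^ r) x v → Walk M (γ + r) w v → Walk M γ w x
  reroute {v = v} {w = w} {r} {x} x→v p with indec v x
  -- Going from `x` to `v` and back is a closed walk of length `r + s`, so this length is a multiple
  -- `c * d`.
  ... | s , _ , v→x with period∣closed indec period (^-pos-+ r x→v v→x)
  ... | divides c r+s≡cd =
    pos⇒walk binary γ
      (reduce-length periodic c
        (subst (λ t → 0 < (M ^ t) w x)
          (trans (+-assoc γ r s) (cong (γ +_) r+s≡cd))
          (^-pos-+ (γ + r) (walk⇒pos (γ + r) p) v→x)))

  extend-shelling : ∀ {ℓ} (_≺_ : Rel _ ℓ) r →
    ShellingCondition M _≺_ (suc γ) → ShellingCondition M _≺_ (suc (γ + r))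
  extend-shelling _≺_ r S u v p p′ v₁′≺v₁ =
    -- The part of `p` after its vertex number `suc γ` has length `r`, and `tail p′` has length
    -- `γ + r`, as `reroute` requires.
    let q = reroute (suffix-pos (suc γ) p) (tail p′)
        j , w , w≺ , e₁ , e₂ =
          S u _ (prefix (suc γ) p) (cons (first-edge p′) q)
            (subst (_≺ _) (sym (start q)) v₁′≺v₁)
        eq = sym (inject₁-↑ˡ j r)
    -- An interior position of the prefix is interior in `p` too. Only positions involving `inject₁`
    -- need transport; `e₂` fits by computation.
    in j ↑ˡ r , w
     , subst (λ z → w ≺ vertex p (suc z)) eq w≺
     , subst (λ z → Edge M (vertex p z) w)
         (trans (sym (inject₁-↑ˡ (inject₁ j) r)) (cong inject₁ eq)) e₁
     , e₂

theorem6p4 : ∀ {ℓ : Level} (n : ℕ) (M : Matrix n) → IsBinary M → Indecomposable M →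
    (i : Fin n) (d γ : ℕ) → IsPeriodAt M i d → IsIndex M d γ →
    (_≺_ : Rel (Fin n) ℓ) → IsStrictTotalOrder _≡_ _≺_ →
    IsVertexShellingOrder M _≺_ ⇔
    (∀ k → .{{_ : NonZero k}} → k ≤ γ + d → ShellingCondition M _≺_ k)
theorem6p4 n M binary indec i d γ period (periodic , _) _≺_ _ =
  mk⇔ (λ S k .⦃ _ ⦄ _ → S k) all-lengths
  where
  all-lengths : (∀ k → .{{_ : NonZero k}} → k ≤ γ + d → ShellingCondition M _≺_ k) →
                IsVertexShellingOrder M _≺_
  all-lengths S (suc m) with ≤-<-connex (suc m) (γ + d)
  ... | inj₁ k≤γ+d = S (suc m) k≤γ+d
  -- Here `k` is `suc m`, and `γ ≤ m` suffices to write it as `suc (γ + r)`.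
  ... | inj₂ (s≤s γ+d≤m) with m≤n⇒∃[o]m+o≡n (≤-trans (m≤m+n γ d) γ+d≤m)
  ... | r , refl =
    extend-shelling binary indec period periodic _≺_ r
      (S (suc γ) (m<m+n γ (period>0 indec period)))
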